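{- Let $G$ be a graph with minimum degree $\delta$ and order $n$, where $n\ge 2\delta+2$. Then $\gamma_{\rm i}(G)=n-\delta$ if and only if $G$ contains a spanning subgraph isomorphic to $K_{\delta,n-\delta}$ such that the part of the bipartition of size $n-\delta$ is an independent set in $G$.
   Context: All graphs are finite and simple. Indicated domination game on $G$: two players, Dominator and Staller, alternate. In each round Dominator indicates a vertex $v$ not yet dominated by the vertices previously selected by Staller (a vertex dominates itself and its neighbors), and Staller must select a vertex of the closed neighborhood $N[v]$, adding it to a set $D$. The game ends when $D$ is a dominating set of $G$. Dominator wants to minimize $|D|$ and Staller to maximize it; the size of $D$ under optimal play of both is the indicated domination number $\gamma_{\rm i}(G)$. -}

module Defs where

open import Data.Fin.Base using (Fin)
import Data.Fin.Properties as Fin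
open import Data.Fin.Subset using (Subset; ⊥; ⁅_⁆; ∣_∣; _∪_; _∈_; _∉_)
open import Data.Fin.Subset.Properties using (_∈?_; ∈⊤; ∣p∣≤n; ∣p∣≡n⇒p≡⊤; p⊂q⇒∣p∣<∣q∣; p⊆p∪q; q⊆p∪q; x∈⁅x⁆)
open import Data.List.Base using (List; []; _∷_; allFin; filter; length; map)
open import Data.List.Extrema.Nat using (min; max)
open import Data.List.Properties using (map-cong-local)
import Data.List.Relation.Unary.All as All
open import Data.List.Relation.Unary.All.Properties using (all-filter)
open import Data.Nat.Base using (ℕ; zero; suc; _+_; _≤_)
import Data.Nat.Properties as ℕ
open import Data.Product.Base using (_×_; _,_; ∃-syntax; Σ-syntax)
open import Data.Sum.Base using (_⊎_; inj₁; inj₂)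
open import Function.Bundles using (_⇔_; _↔_; Inverse)
open import Relation.Binary.Core using (Rel)
open import Relation.Binary.Definitions using (Decidable; Irreflexive; Symmetric)
open import Relation.Binary.PropositionalEquality using (_≡_; refl; sym; cong; subst)
open import Relation.Nullary.Decidable using (Dec; yes; no; ¬?; _×-dec_; _⊎-dec_)
open import Relation.Nullary.Negation using (¬_; contradiction)
open import Relation.Unary using (Pred)
open import Level using (0ℓ)

record Graph (V : Set) : Set₁ where
  field
    _∼_      : Rel V 0ℓ
    _∼?_     : Decidable _∼_
    ∼-sym    : Symmetric _∼_
    ∼-irrefl : Irreflexive _≡_ _∼_

data CrossAdj {A B : Set} : Rel (A ⊎ B) 0ℓ where
  left-right : ∀ {a b} → CrossAdj (inj₁ a) (inj₂ b)
  right-left : ∀ {a b} → CrossAdj (inj₂ b) (inj₁ a)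

K : (p q : ℕ) → Graph (Fin p ⊎ Fin q)
K p q = record
  { _∼_      = CrossAdj
  ; _∼?_     = dec
  ; ∼-sym    = λ where
      left-right → right-left
      right-left → left-right
  ; ∼-irrefl = λ where
      refl ()
  }
  where
  dec : Decidable CrossAdj
  dec (inj₁ _) (inj₁ _) = no λ ()
  dec (inj₁ _) (inj₂ _) = yes left-right
  dec (inj₂ _) (inj₁ _) = yes right-left
  dec (inj₂ _) (inj₂ _) = no λ ()

-- H and G have the same vertex set, so every such subgraph is spanning.
SpanningSubgraph : ∀ {V} → Graph V → Graph V → Set
SpanningSubgraph H G = ∀ {u v} → u H.∼ v → u G.∼ v
  where
  module H = Graph H
  module G = Graph G

record _≅_ {V W : Set} (G : Graph V) (H : Graph W) : Set where
  private
    module G = Graph G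
    module H = Graph H
  field
    bijection : V ↔ W
  open Inverse bijection public using (to)
  field
    adjacency : ∀ u v → (u G.∼ v) ⇔ (to u H.∼ to v)

Independent : ∀ {V} → Graph V → Pred V 0ℓ → Set
Independent G S = ∀ {u v} → S u → S v → ¬ (u ∼ v)
  where open Graph G

rightPart : ∀ {V p q} {H : Graph V} → K p q ≅ H → Pred V 0ℓ
rightPart φ v = ∃[ j ] _≅_.to φ (inj₂ j) ≡ v

ContainsSpanningKWithIndependentPart : ∀ {n} → Graph (Fin n) → (p q : ℕ) → Set₁
ContainsSpanningKWithIndependentPart {n} G p q =
  Σ[ H ∈ Graph (Fin n) ] SpanningSubgraph H G ×
    (Σ[ φ ∈ K p q ≅ H ] Independent G (rightPart φ))

degree : ∀ {n} → Graph (Fin n) → Fin n → ℕ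
degree {n} G v = length (filter (v ∼?_) (allFin n))
  where open Graph G

MinimumDegree : ∀ {n} → Graph (Fin n) → ℕ → Set
MinimumDegree G δ = (∃[ v ] degree G v ≡ δ) × (∀ v → δ ≤ degree G v)

minimumOr : ℕ → List ℕ → ℕ
minimumOr d []       = d
minimumOr d (x ∷ xs) = min x xs

module IndicatedDominationGame {n : ℕ} (G : Graph (Fin n)) where
  open Graph G

  _∈N[_] : Fin n → Fin n → Set
  u ∈N[ v ] = u ≡ v ⊎ u ∼ v

  _∈N[_]? : ∀ u v → Dec (u ∈N[ v ])
  u ∈N[ v ]? = (u Fin.≟ v) ⊎-dec (u ∼? v)

  Dominated : Subset n → Fin n → Set
  Dominated D v = ∃[ u ] u ∈ D × u ∈N[ v ]

  dominated? : ∀ D v → Dec (Dominated D v)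
  dominated? D v = Fin.any? λ u → (u ∈? D) ×-dec (u ∈N[ v ]?)

  undominated : Subset n → List (Fin n)
  undominated D = filter (λ v → ¬? (dominated? D v)) (allFin n)

  N[_] : Fin n → List (Fin n)
  N[ v ] = filter (_∈N[ v ]?) (allFin n)

  -- One round of minimax from position D, where `next` evaluates the position
  -- after the round.  The game is over, with result ∣ D ∣, exactly when the list
  -- of undominated vertices is empty.  As N[ v ] is never empty, the default 0
  -- of the maximum plays no role.
  round : (Subset n → ℕ) → Subset n → ℕ
  round next D =
    minimumOr ∣ D ∣
      (map (λ v → max 0 (map (λ u → next (D ∪ ⁅ u ⁆)) N[ v ])) (undominated D))

  -- The minimax value of the game cut off after k further rounds.
  valueWithin : ℕ → Subset n → ℕ
  valueWithin zero    D = ∣ D ∣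
  valueWithin (suc k) D = round (valueWithin k) D

  -- Every round enlarges D, so n rounds always suffice; `value-minimax` below
  -- confirms that the cutoff is never felt.
  value : Subset n → ℕ
  value = valueWithin n

  private
    fresh : ∀ {D u v} → ¬ Dominated D v → u ∈N[ v ] → u ∉ D
    fresh ¬dom u∈N u∈D = ¬dom (_ , u∈D , u∈N)

    grows : ∀ {D : Subset n} {u} → u ∉ D → suc ∣ D ∣ ≤ ∣ D ∪ ⁅ u ⁆ ∣
    grows {D} {u} u∉D = p⊂q⇒∣p∣<∣q∣
      (p⊆p∪q ⁅ u ⁆ , u , q⊆p∪q D ⁅ u ⁆ (x∈⁅x⁆ u) , u∉D)

    round-cong : ∀ {f g} D →
                 (∀ u → u ∉ D → f (D ∪ ⁅ u ⁆) ≡ g (D ∪ ⁅ u ⁆)) →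
                 round f D ≡ round g D
    round-cong D f≗g = cong (minimumOr ∣ D ∣)
      (map-cong-local (All.map
        (λ {v} ¬dom → cong (max 0) (map-cong-local (All.map
          (λ {u} u∈N → f≗g u (fresh ¬dom u∈N))
          (all-filter (_∈N[ v ]?) (allFin n)))))
        (all-filter (λ v → ¬? (dominated? D v)) (allFin n))))

    round-full : ∀ f D → n ≤ ∣ D ∣ → round f D ≡ ∣ D ∣
    round-full f D n≤∣D∣
      with undominated D | all-filter (λ v → ¬? (dominated? D v)) (allFin n)
    ... | []    | _              = refl
    ... | v ∷ _ | ¬dom All.∷ _ = contradiction (v , v∈D , inj₁ refl) ¬dom
      where
      v∈D : v ∈ D
      v∈D = subst (v ∈_) (sym (∣p∣≡n⇒p≡⊤ (ℕ.≤-antisym (∣p∣≤n D) n≤∣D∣))) ∈⊤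

    stable : ∀ k D → n ≤ k + ∣ D ∣ → valueWithin (suc k) D ≡ valueWithin k D
    stable zero    D n≤ = round-full (valueWithin zero) D n≤
    stable (suc k) D n≤ = round-cong {valueWithin (suc k)} {valueWithin k} D λ u u∉D → stable k (D ∪ ⁅ u ⁆)
      (ℕ.≤-trans n≤ (ℕ.≤-trans (ℕ.≤-reflexive (sym (ℕ.+-suc k ∣ D ∣)))
        (ℕ.+-monoʳ-≤ k (grows u∉D))))

  value-minimax : ∀ D → value D ≡ round value D
  value-minimax D = sym (stable n D (ℕ.m≤m+n n ∣ D ∣))

γᵢ : ∀ {n} → Graph (Fin n) → ℕ
γᵢ G = IndicatedDominationGame.value G ⊥

{-# OPTIONS --safe #-}

-- The first reply u dominates deg u + 1 ≥ δ + 1 vertices, and each later reply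
-- at least one new vertex, the indicated one, so γᵢ(G) ≤ n − δ.
-- Equality forces the first reply u to have degree δ, and leaves a set U of
-- n − δ − 1 undominated vertices such that to every v ∈ U Staller can reply with
-- a vertex dominating nothing in U but v: either v itself, isolated in G[U], or
-- a private neighbour of v in N(u).  As ∣U∣ > δ = ∣N(u)∣, some v₀ ∈ U has no
-- private neighbour in N(u); then N(v₀) ⊆ N(u), so N(v₀) = N(u) by degrees, and
-- no vertex of N(u) can be private to anyone but v₀.  Hence all of U is
-- isolated in G[U], and V ∖ N(u) is the independent part.
--
-- Conversely, Staller can keep all replies inside an independent dominating set
-- B, and then the game ends only when all of B has been selected.

module Submission where

open import Defs
open import Data.Fin.Base using (Fin; fromℕ<; zero; suc)
open import Data.Fin.Permutation using (↔⇒≡)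
import Data.Fin.Properties as Fin
open import Data.Fin.Subset using (Subset; ⊥; ⁅_⁆; ∣_∣; _∪_; _-_; _∈_; inside; outside)
open import Data.Fin.Subset.Properties using (p⊆p∪q; q⊆p∪q; x∈⁅x⁆; x∈⁅y⁆⇒x≡y; x∈p∪q⁻; ∪-identityʳ; ∉⊥; ∣⊥∣≡0; x∈p∧x≢y⇒x∈p-y; x∈p⇒∣p-x∣<∣p∣; p⊂q⇒∣p∣<∣q∣)
open import Data.List.Base using (List; []; _∷_; _++_; allFin; filter; length; lookup; map)
open import Data.List.Extrema.Nat using (max; min≤⊤; min≤xs; v≤min⁺; v≤max⁺; argmax-sel)
open import Data.List.Membership.Propositional using (lose) renaming (_∈_ to _∈ₗ_)
open import Data.List.Membership.Propositional.Properties using (∈-allFin; ∈-filter⁺; ∈-filter⁻; ∈-lookup; ∈-map⁺; ∈-map⁻; ∈-++⁻)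
open import Data.List.Membership.Setoid.Properties using (index-injective)
open import Data.List.Properties using (length-++; length-filter; length-tabulate)
open import Data.List.Relation.Unary.All as All using (All; []; _∷_)
open import Data.List.Relation.Unary.All.Properties using (all-filter; map⁺)
open import Data.List.Relation.Unary.AllPairs using ([]; _∷_)
open import Data.List.Relation.Unary.Any as Any using (here; there)
open import Data.List.Relation.Unary.Any.Properties using (lookup-index)
open import Data.List.Relation.Unary.Unique.Propositional using (Unique)
open import Data.List.Relation.Unary.Unique.Propositional.Properties using (++⁺; allFin⁺; filter⁺)
open import Data.Nat.Base using (ℕ; zero; suc; _+_; _*_; _∸_; _≤_; _<_; _≥_; z≤n; s≤s)
import Data.Nat.Properties as ℕ
open import Data.Nat.Tactic.RingSolver using (solve-∀)
open import Data.Product.Base using (_×_; _,_; ∃-syntax; proj₁; proj₂)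
open import Data.Sum.Base using (_⊎_; inj₁; inj₂)
open import Data.Sum.Properties using (inj₂-injective)
open import Data.Vec.Base using (_∷_)
open import Function.Base using (id; _∘_)
open import Function.Bundles using (_⇔_; _↔_; mk⇔; mk↔ₛ′; Equivalence; Inverse)
open import Function.Construct.Composition using (_↔-∘_)
open import Function.Definitions using (Injective)
open import Level using (0ℓ)
open import Relation.Binary.PropositionalEquality using (_≡_; _≢_; refl; sym; trans; cong; subst; setoid)
open import Relation.Nullary.Decidable using (yes; no; ¬?; _×-dec_; _⊎-dec_; decidable-stable)
open import Relation.Nullary.Negation using (¬_; contradiction)
open import Relation.Unary using (Pred; Decidable)

-- Counting in lists and subsets

lookup-injective : ∀ {A : Set} {xs : List A} → Unique xs → Injective _≡_ _≡_ (lookup xs)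
lookup-injective (_   ∷ _)  {zero}  {zero}  _  = refl
lookup-injective (x∉  ∷ _)  {zero}  {suc j} eq = contradiction eq (All.lookup x∉ (∈-lookup j))
lookup-injective (x∉  ∷ _)  {suc i} {zero}  eq = contradiction (sym eq) (All.lookup x∉ (∈-lookup i))
lookup-injective (_   ∷ xs!) {suc i} {suc j} eq = cong suc (lookup-injective xs! eq)

-- Positions in `xs` go injectively to positions in `ys`. The map `f` takes the membership proof
-- because private neighbours will be available only for members of the list.
injection⇒length≤ : ∀ {A B : Set} {xs : List A} {ys : List B} → Unique xs →
                    (f : ∀ {x} → x ∈ₗ xs → B) → (∀ {x} (x∈ : x ∈ₗ xs) → f x∈ ∈ₗ ys) →
                    (∀ {x y} (x∈ : x ∈ₗ xs) (y∈ : y ∈ₗ xs) → f x∈ ≡ f y∈ → x ≡ y) →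
                    length xs ≤ length ys
injection⇒length≤ {B = B} xs! f f∈ f-inj = Fin.injective⇒≤
  {f = λ i → Any.index (f∈ (∈-lookup i))}
  λ eq → lookup-injective xs! (f-inj _ _ (index-injective (setoid B) (f∈ _) (f∈ _) eq))

⊆⇒length≤ : ∀ {A : Set} {xs ys : List A} → Unique xs → (∀ {x} → x ∈ₗ xs → x ∈ₗ ys) →
            length xs ≤ length ys
⊆⇒length≤ xs! xs⊆ys = injection⇒length≤ xs! (λ {x} _ → x) xs⊆ys (λ _ _ → id)

injective⇒≤∣_∣ : ∀ {m n} (D : Subset n) {f : Fin m → Fin n} → Injective _≡_ _≡_ f →
                (∀ i → f i ∈ D) → m ≤ ∣ D ∣
injective⇒≤∣_∣ {zero}  D inj f∈D = z≤n
injective⇒≤∣_∣ {suc m} D {f} inj f∈D = ℕ.≤-<-trans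
  (injective⇒≤∣ D - f zero ∣ (λ eq → Fin.suc-injective (inj eq))
    λ i → x∈p∧x≢y⇒x∈p-y (f∈D (suc i)) λ eq → contradiction (inj eq) λ ())
  (x∈p⇒∣p-x∣<∣p∣ (f∈D zero))

∣p∪⁅x⁆∣≤1+∣p∣ : ∀ {n} (p : Subset n) x → ∣ p ∪ ⁅ x ⁆ ∣ ≤ suc ∣ p ∣
∣p∪⁅x⁆∣≤1+∣p∣ (inside  ∷ p) zero rewrite ∪-identityʳ p = ℕ.n≤1+n _
∣p∪⁅x⁆∣≤1+∣p∣ (outside ∷ p) zero rewrite ∪-identityʳ p = ℕ.≤-refl
∣p∪⁅x⁆∣≤1+∣p∣ (inside  ∷ p) (suc x) = s≤s (∣p∪⁅x⁆∣≤1+∣p∣ p x)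
∣p∪⁅x⁆∣≤1+∣p∣ (outside ∷ p) (suc x) = ∣p∪⁅x⁆∣≤1+∣p∣ p x

∣⊥∪⁅x⁆∣≤1 : ∀ {n} (x : Fin n) → ∣ ⊥ ∪ ⁅ x ⁆ ∣ ≤ 1
∣⊥∪⁅x⁆∣≤1 {n} x = ℕ.≤-trans (∣p∪⁅x⁆∣≤1+∣p∣ ⊥ x) (s≤s (ℕ.≤-reflexive (∣⊥∣≡0 n)))

x∉p⇒∣p∣<∣p∪⁅x⁆∣ : ∀ {n} (p : Subset n) {x} → ¬ x ∈ p → ∣ p ∣ < ∣ p ∪ ⁅ x ⁆ ∣
x∉p⇒∣p∣<∣p∪⁅x⁆∣ p {x} x∉p =
  p⊂q⇒∣p∣<∣q∣ (p⊆p∪q ⁅ x ⁆ , x , q⊆p∪q p ⁅ x ⁆ (x∈⁅x⁆ x) , x∉p)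

-- Splitting `Fin n` along a decidable predicate

module _ {n} {P : Pred (Fin n) 0ℓ} (P? : Decidable P) where

  private
    ps qs : List (Fin n)
    ps = filter P? (allFin n)
    qs = filter (¬? ∘ P?) (allFin n)

    holds : ∀ i → P (lookup ps i)
    holds i = proj₂ (∈-filter⁻ P? {xs = allFin n} (∈-lookup i))

    fails : ∀ j → ¬ P (lookup qs j)
    fails j = proj₂ (∈-filter⁻ (¬? ∘ P?) {xs = allFin n} (∈-lookup j))

  splitting : (Fin (length ps) ⊎ Fin (length qs)) ↔ Fin n
  -- Only one inverse law is checked directly; the other follows from it because `to` is injective.
  splitting = mk↔ₛ′ to from to∘from λ x → to-injective (to∘from (to x))
    where
    to : Fin (length ps) ⊎ Fin (length qs) → Fin n
    to (inj₁ i) = lookup ps i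
    to (inj₂ j) = lookup qs j

    to-injective : Injective _≡_ _≡_ to
    to-injective {inj₁ i} {inj₁ j} eq = cong inj₁ (lookup-injective (filter⁺ P? (allFin⁺ n)) eq)
    to-injective {inj₁ i} {inj₂ j} eq = contradiction (subst P eq (holds i)) (fails j)
    to-injective {inj₂ i} {inj₁ j} eq = contradiction (subst P (sym eq) (holds j)) (fails i)
    to-injective {inj₂ i} {inj₂ j} eq =
      cong inj₂ (lookup-injective (filter⁺ (¬? ∘ P?) (allFin⁺ n)) eq)

    side : ∀ x → x ∈ₗ ps ⊎ x ∈ₗ qs
    side x with P? x
    ... | yes px = inj₁ (∈-filter⁺ P? (∈-allFin x) px)
    ... | no ¬px = inj₂ (∈-filter⁺ (¬? ∘ P?) (∈-allFin x) ¬px)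

    from : Fin n → Fin (length ps) ⊎ Fin (length qs)
    from x with side x
    ... | inj₁ x∈ = inj₁ (Any.index x∈)
    ... | inj₂ x∈ = inj₂ (Any.index x∈)

    to∘from : ∀ x → to (from x) ≡ x
    to∘from x with side x
    ... | inj₁ x∈ = sym (lookup-index x∈)
    ... | inj₂ x∈ = sym (lookup-index x∈)

  splitting₁ : ∀ i → P (Inverse.to splitting (inj₁ i))
  splitting₁ = holds

  splitting₂ : ∀ j → ¬ P (Inverse.to splitting (inj₂ j))
  splitting₂ = fails

  length-complement : length qs ≡ n ∸ length ps
  length-complement = trans (sym (ℕ.m+n∸m≡n (length ps) (length qs)))
    (cong (_∸ length ps) (↔⇒≡ (splitting ↔-∘ Fin.+↔⊎)))

-- The value of a round

minimumOr≤ : ∀ {d x} {xs : List ℕ} → x ∈ₗ xs → minimumOr d xs ≤ x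
minimumOr≤ {xs = y ∷ ys} (here refl) = min≤⊤ y ys
minimumOr≤ {xs = y ∷ ys} (there x∈)  = All.lookup (min≤xs y ys) x∈

≤minimumOr : ∀ {d v} {xs : List ℕ} → (xs ≡ [] → v ≤ d) → All (v ≤_) xs → v ≤ minimumOr d xs
≤minimumOr v≤d []         = v≤d refl
≤minimumOr v≤d (v≤x ∷ v≤) = v≤min⁺ v≤x v≤

module _ {n} (G : Graph (Fin n)) where
  open Graph G
  open IndicatedDominationGame G

  private
    neighbours : Fin n → List (Fin n)
    neighbours v = filter (v ∼?_) (allFin n)

  undominated⁺ : ∀ {D v} → ¬ Dominated D v → v ∈ₗ undominated D
  undominated⁺ {D} ¬dom = ∈-filter⁺ (¬? ∘ dominated? D) (∈-allFin _) ¬dom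

  undominated⁻ : ∀ {D v} → v ∈ₗ undominated D → ¬ Dominated D v
  undominated⁻ {D} v∈ = proj₂ (∈-filter⁻ (¬? ∘ dominated? D) {xs = allFin n} v∈)

  undominated-unique : ∀ D → Unique (undominated D)
  undominated-unique D = filter⁺ (¬? ∘ dominated? D) (allFin⁺ n)

  ¬dominated-⊥ : ∀ {v} → ¬ Dominated ⊥ v
  ¬dominated-⊥ (_ , u∈⊥ , _) = ∉⊥ u∈⊥

  dominated-∪ˡ : ∀ {D} u {v} → Dominated D v → Dominated (D ∪ ⁅ u ⁆) v
  dominated-∪ˡ u (x , x∈D , x∈N) = x , p⊆p∪q ⁅ u ⁆ x∈D , x∈N

  dominated-∪ʳ : ∀ D {u v} → u ∈N[ v ] → Dominated (D ∪ ⁅ u ⁆) v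
  dominated-∪ʳ D {u} u∈N = u , q⊆p∪q D ⁅ u ⁆ (x∈⁅x⁆ u) , u∈N

  dominated-∪⁻ : ∀ {D u v} → Dominated (D ∪ ⁅ u ⁆) v → Dominated D v ⊎ u ∈N[ v ]
  dominated-∪⁻ {D} {u} (x , x∈ , x∈N) with x∈p∪q⁻ D ⁅ u ⁆ x∈
  ... | inj₁ x∈D = inj₁ (x , x∈D , x∈N)
  ... | inj₂ x∈u with refl ← x∈⁅y⁆⇒x≡y u x∈u = inj₂ x∈N

  indicating : (Subset n → ℕ) → Subset n → Fin n → ℕ
  indicating next D v = max 0 (map (λ u → next (D ∪ ⁅ u ⁆)) N[ v ])

  round-≤-reply : ∀ next {D v} → ¬ Dominated D v →
                  ∃[ u ] u ∈N[ v ] × round next D ≤ next (D ∪ ⁅ u ⁆)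
  round-≤-reply next {D} {v} ¬dom
    with argmax-sel id 0 (map (λ u → next (D ∪ ⁅ u ⁆)) N[ v ])
       | minimumOr≤ {∣ D ∣} (∈-map⁺ (indicating next D) (undominated⁺ ¬dom))
  -- If `max` returns its default 0, the round is worth at most 0 and any reply will do, for
  -- instance `v`.
  ... | inj₁ max≡0 | round≤max =
    v , inj₁ refl , ℕ.≤-trans round≤max (ℕ.≤-trans (ℕ.≤-reflexive max≡0) z≤n)
  ... | inj₂ max∈  | round≤max with ∈-map⁻ _ max∈
  ...   | u , u∈N , max≡ = u , proj₂ (∈-filter⁻ (_∈N[ v ]?) {xs = allFin n} u∈N) ,
                           ℕ.≤-trans round≤max (ℕ.≤-reflexive max≡)

  -- The second premise is one move of a Staller strategy: each inner maximum is at least the value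
  -- of the given reply, hence so is their minimum. If there is nothing to indicate, the first
  -- premise decides.
  ≤-round : ∀ next D {m} → ((∀ v → Dominated D v) → m ≤ ∣ D ∣) →
            (∀ {v} → ¬ Dominated D v → ∃[ u ] u ∈N[ v ] × m ≤ next (D ∪ ⁅ u ⁆)) →
            m ≤ round next D
  ≤-round next D {m} over reply = ≤minimumOr
    (λ eq → over λ v → decidable-stable (dominated? D v) λ ¬dom →
      contradiction (subst (indicating next D v ∈ₗ_) eq (∈-map⁺ (indicating next D) (undominated⁺ ¬dom))) λ ())
    (map⁺ (All.map bound (all-filter (¬? ∘ dominated? D) (allFin n))))
    where
    bound : ∀ {v} → ¬ Dominated D v → m ≤ indicating next D v
    bound {v} ¬dom with reply ¬dom
    ... | u , u∈N , m≤ = v≤max⁺ 0 _ (inj₂ (lose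
      (∈-map⁺ _ (∈-filter⁺ (_∈N[ v ]?) (∈-allFin u) u∈N)) m≤))

  -- By `value-minimax` the same `value` stands on both sides, so rounds can be chained without
  -- tracking how many remain.
  value-≤-reply : ∀ {D v} → ¬ Dominated D v → ∃[ u ] u ∈N[ v ] × value D ≤ value (D ∪ ⁅ u ⁆)
  value-≤-reply {D} ¬dom with round-≤-reply value ¬dom
  ... | u , u∈N , le = u , u∈N , ℕ.≤-trans (ℕ.≤-reflexive (value-minimax D)) le

  -- The upper bound by counting undominated vertices

  undominated-shrinks : ∀ {D u ws} → Unique ws →
    (∀ {w} → w ∈ₗ ws → ¬ Dominated D w × u ∈N[ w ]) →
    length ws + length (undominated (D ∪ ⁅ u ⁆)) ≤ length (undominated D)
  undominated-shrinks {D} {u} {ws} ws! new = ℕ.≤-trans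
    (ℕ.≤-reflexive (sym (length-++ ws)))
    (⊆⇒length≤ (++⁺ ws! (undominated-unique _) disjoint) included)
    where
    disjoint : ∀ {w} → ¬ (w ∈ₗ ws × w ∈ₗ undominated (D ∪ ⁅ u ⁆))
    disjoint (w∈ , w∈U) = undominated⁻ w∈U (dominated-∪ʳ D (proj₂ (new w∈)))

    included : ∀ {w} → w ∈ₗ ws ++ undominated (D ∪ ⁅ u ⁆) → w ∈ₗ undominated D
    included w∈ with ∈-++⁻ ws w∈
    ... | inj₁ w∈ws = undominated⁺ (proj₁ (new w∈ws))
    ... | inj₂ w∈U  = undominated⁺ (undominated⁻ w∈U ∘ dominated-∪ˡ u)

  -- A reply adds at most one vertex to `D` and newly dominates at least the indicated one, so the
  -- right-hand sum never grows, whatever Dominator indicates.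
  valueWithin≤ : ∀ k D → valueWithin k D ≤ ∣ D ∣ + length (undominated D)
  valueWithin≤ zero    D = ℕ.m≤m+n _ _
  valueWithin≤ (suc k) D = split (undominated D) refl
    where
    step : ∀ {v} → ¬ Dominated D v → valueWithin (suc k) D ≤ ∣ D ∣ + length (undominated D)
    step ¬dom with round-≤-reply (valueWithin k) ¬dom
    ... | u , u∈N , le = begin
      valueWithin (suc k) D                                   ≤⟨ le ⟩
      valueWithin k (D ∪ ⁅ u ⁆)                               ≤⟨ valueWithin≤ k (D ∪ ⁅ u ⁆) ⟩
      ∣ D ∪ ⁅ u ⁆ ∣ + length (undominated (D ∪ ⁅ u ⁆))        ≤⟨ ℕ.+-monoˡ-≤ _ (∣p∪⁅x⁆∣≤1+∣p∣ D u) ⟩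
      suc ∣ D ∣ + length (undominated (D ∪ ⁅ u ⁆))            ≡⟨ ℕ.+-suc ∣ D ∣ _ ⟨
      ∣ D ∣ + suc (length (undominated (D ∪ ⁅ u ⁆)))          ≤⟨ ℕ.+-monoʳ-≤ ∣ D ∣ (undominated-shrinks ([] ∷ []) λ where
                                                                   (here refl) → ¬dom , u∈N) ⟩
      ∣ D ∣ + length (undominated D)                          ∎
      where open ℕ.≤-Reasoning

    split : ∀ vs → undominated D ≡ vs → valueWithin (suc k) D ≤ ∣ D ∣ + length (undominated D)
    -- The game is over here, and the round takes its default value `∣ D ∣`.
    split []      eq = ℕ.≤-trans
      (ℕ.≤-reflexive (cong (λ vs → minimumOr ∣ D ∣ (map (indicating (valueWithin k) D) vs)) eq))
      (ℕ.m≤m+n _ _)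
    split (v ∷ _) eq = step (undominated⁻ (subst (v ∈ₗ_) (sym eq) (here refl)))

  degree+undominated< : ∀ u → degree G u + suc (length (undominated (⊥ ∪ ⁅ u ⁆))) ≤ n
  degree+undominated< u = begin
    degree G u + suc (length (undominated (⊥ ∪ ⁅ u ⁆)))  ≡⟨ ℕ.+-suc (degree G u) _ ⟩
    suc (degree G u) + length (undominated (⊥ ∪ ⁅ u ⁆))  ≤⟨ undominated-shrinks closed! closed ⟩
    length (undominated ⊥)                               ≤⟨ length-filter (¬? ∘ dominated? ⊥) (allFin n) ⟩
    length (allFin n)                                    ≡⟨ length-tabulate id ⟩
    n                                                    ∎
    where
    open ℕ.≤-Reasoning

    closed! : Unique (u ∷ neighbours u)
    closed! = All.map (λ u∼w u≡w → ∼-irrefl u≡w u∼w) (all-filter (u ∼?_) (allFin n))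
            ∷ filter⁺ (u ∼?_) (allFin⁺ n)

    closed : ∀ {w} → w ∈ₗ u ∷ neighbours u → ¬ Dominated ⊥ w × u ∈N[ w ]
    closed (here refl) = ¬dominated-⊥ , inj₁ refl
    closed (there w∈)  = ¬dominated-⊥ , inj₂ (proj₂ (∈-filter⁻ (u ∼?_) {xs = allFin n} w∈))

  -- The given vertex is Dominator's first indication, chosen arbitrarily. Both bounds are kept: the
  -- second forces many vertices to stay undominated when `γᵢ G` is large, and the first allows a
  -- further round from the same position.
  first-reply : Fin n → ∃[ u ] γᵢ G ≤ value (⊥ ∪ ⁅ u ⁆)
                             × γᵢ G ≤ suc (length (undominated (⊥ ∪ ⁅ u ⁆)))
  first-reply v with value-≤-reply {⊥} {v} ¬dominated-⊥
  ... | u , _ , le = u , le ,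
    ℕ.≤-trans le (ℕ.≤-trans (valueWithin≤ n (⊥ ∪ ⁅ u ⁆)) (ℕ.+-monoˡ-≤ _ (∣⊥∪⁅x⁆∣≤1 u)))

  γᵢ≤n∸δ : ∀ {δ} → MinimumDegree G δ → γᵢ G ≤ n ∸ δ
  γᵢ≤n∸δ {δ} ((v , _) , δ≤deg) with first-reply v
  ... | u , _ , le = ℕ.≤-trans le (ℕ.m+n≤o⇒m≤o∸n _ (begin
    suc (length (undominated (⊥ ∪ ⁅ u ⁆))) + δ            ≡⟨ ℕ.+-comm _ δ ⟩
    δ + suc (length (undominated (⊥ ∪ ⁅ u ⁆)))            ≤⟨ ℕ.+-monoˡ-≤ _ (δ≤deg u) ⟩
    degree G u + suc (length (undominated (⊥ ∪ ⁅ u ⁆)))   ≤⟨ degree+undominated< u ⟩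
    n                                                     ∎))
    where open ℕ.≤-Reasoning

  -- The lower bound from an independent dominating set

  independent-dominating⇒≤γᵢ : ∀ {q} (b : Fin q → Fin n) → Injective _≡_ _≡_ b →
    (∀ i j → ¬ b i ∼ b j) → (∀ v → ∃[ j ] b j ∈N[ v ]) → q ≤ γᵢ G
  independent-dominating⇒≤γᵢ {q} b b-inj indep dominating =
    go n ⊥ (λ x∈⊥ → contradiction x∈⊥ ∉⊥)
       (ℕ.≤-trans (Fin.injective⇒≤ b-inj) (ℕ.m≤m+n n _))
    where
    -- Invariant: `D` stays inside the image of `b`, and the `k` remaining rounds are enough to
    -- bring `∣ D ∣` up to `q`, since every reply is a new vertex.
    go : ∀ k D → (∀ {x} → x ∈ D → ∃[ j ] b j ≡ x) → q ≤ k + ∣ D ∣ → q ≤ valueWithin k D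
    go zero    D D⊆B q≤ = q≤
    go (suc k) D D⊆B q≤ = ≤-round (valueWithin k) D over reply
      where
      over : (∀ v → Dominated D v) → q ≤ ∣ D ∣
      over dom = injective⇒≤∣ D ∣ b-inj b∈D
        where
        b∈D : ∀ i → b i ∈ D
        -- Whatever dominates `b i` from `D` is itself a value of `b`, so by independence it can
        -- only be `b i`.
        b∈D i with dom (b i)
        ... | u , u∈D , inj₁ refl = u∈D
        ... | u , u∈D , inj₂ u∼b with D⊆B u∈D
        ...   | j , refl = contradiction u∼b (indep j i)

      reply : ∀ {v} → ¬ Dominated D v → ∃[ u ] u ∈N[ v ] × q ≤ valueWithin k (D ∪ ⁅ u ⁆)
      reply {v} ¬dom with dominating v
      ... | j , b∈N = b j , b∈N , go k (D ∪ ⁅ b j ⁆) ⊆B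
        (ℕ.≤-trans q≤ (ℕ.≤-trans (ℕ.≤-reflexive (sym (ℕ.+-suc k ∣ D ∣)))
          (ℕ.+-monoʳ-≤ k (x∉p⇒∣p∣<∣p∪⁅x⁆∣ D λ b∈D → ¬dom (b j , b∈D , b∈N)))))
        where
        ⊆B : ∀ {x} → x ∈ D ∪ ⁅ b j ⁆ → ∃[ i ] b i ≡ x
        ⊆B x∈ with x∈p∪q⁻ D ⁅ b j ⁆ x∈
        ... | inj₁ x∈D = D⊆B x∈D
        ... | inj₂ x∈b = j , sym (x∈⁅y⁆⇒x≡y (b j) x∈b)

  spanningK⇒≤γᵢ : ∀ {p q} → 0 < q → ContainsSpanningKWithIndependentPart G p q → q ≤ γᵢ G
  spanningK⇒≤γᵢ {p} {q} 0<q (H , H⊆G , φ , indep) = independent-dominating⇒≤γᵢ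
    (to ∘ inj₂) (λ eq → inj₂-injective (to-injective eq))
    (λ i j → indep (i , refl) (j , refl))
    (λ v → subst (λ x → ∃[ j ] to (inj₂ j) ∈N[ x ]) (strictlyInverseˡ v) (near (from v)))
    where
    open Inverse (_≅_.bijection φ) using (to; from; strictlyInverseˡ; strictlyInverseʳ)

    to-injective : ∀ {x y} → to x ≡ to y → x ≡ y
    to-injective {x} {y} eq =
      trans (sym (strictlyInverseʳ x)) (trans (cong from eq) (strictlyInverseʳ y))

    near : ∀ x → ∃[ j ] to (inj₂ j) ∈N[ to x ]
    -- Every right vertex is adjacent to this left vertex, and `0<q` provides one.
    near (inj₁ i) = fromℕ< 0<q , inj₂ (H⊆G (Equivalence.to (_≅_.adjacency φ _ _) right-left))
    near (inj₂ j) = j , inj₁ refl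

  -- Building the complete bipartite subgraph

  joined-independent⇒spanningK : ∀ u → (∀ {x y} → ¬ u ∼ x → u ∼ y → x ∼ y) →
    (∀ {x y} → ¬ u ∼ x → ¬ u ∼ y → ¬ x ∼ y) →
    ContainsSpanningKWithIndependentPart G (degree G u) (n ∸ degree G u)
  joined-independent⇒spanningK u joined indep =
    -- The left part N(u) has size `degree G u` by definition; the size of its complement, to which
    -- `u` itself belongs, has to be rewritten.
    subst (ContainsSpanningKWithIndependentPart G (degree G u)) (length-complement (u ∼?_))
      (H , H⊆G , φ , λ where (i , refl) (j , refl) → indep (splitting₂ (u ∼?_) i) (splitting₂ (u ∼?_) j))
    where
    _⋈_ : Fin n → Fin n → Set
    x ⋈ y = (u ∼ x × ¬ u ∼ y) ⊎ (¬ u ∼ x × u ∼ y)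

    H : Graph (Fin n)
    H = record
      { _∼_      = _⋈_
      ; _∼?_     = λ x y → ((u ∼? x) ×-dec ¬? (u ∼? y)) ⊎-dec (¬? (u ∼? x) ×-dec (u ∼? y))
      ; ∼-sym    = λ where
          (inj₁ (a , b)) → inj₂ (b , a)
          (inj₂ (a , b)) → inj₁ (b , a)
      ; ∼-irrefl = λ where
          refl (inj₁ (a , b)) → b a
          refl (inj₂ (a , b)) → a b
      }

    H⊆G : SpanningSubgraph H G
    H⊆G (inj₁ (ux , ¬uy)) = ∼-sym (joined ¬uy ux)
    H⊆G (inj₂ (¬ux , uy)) = joined ¬ux uy

    φ : K (degree G u) _ ≅ H
    φ = record
      { bijection = splitting (u ∼?_)
      ; adjacency = adj
      }
      where
      L = splitting₁ (u ∼?_)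
      R = splitting₂ (u ∼?_)

      adj : ∀ x y → CrossAdj x y ⇔ (Inverse.to (splitting (u ∼?_)) x ⋈ Inverse.to (splitting (u ∼?_)) y)
      adj (inj₁ i) (inj₁ j) = mk⇔ (λ ()) λ where
        (inj₁ (_ , ¬b)) → contradiction (L j) ¬b
        (inj₂ (¬a , _)) → contradiction (L i) ¬a
      adj (inj₁ i) (inj₂ j) = mk⇔ (λ _ → inj₁ (L i , R j)) (λ _ → left-right)
      adj (inj₂ i) (inj₁ j) = mk⇔ (λ _ → inj₂ (R i , L j)) (λ _ → right-left)
      adj (inj₂ i) (inj₂ j) = mk⇔ (λ ()) λ where
        (inj₁ (a , _)) → contradiction a (R i)
        (inj₂ (_ , b)) → contradiction b (R j)

  -- The structure forced by equality in the upper bound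

  module ExtremalFirstReply {δ} (δ≤deg : ∀ v → δ ≤ degree G v) (2δ+2≤n : 2 * δ + 2 ≤ n)
    (u : Fin n) (value≥ : n ∸ δ ≤ value (⊥ ∪ ⁅ u ⁆))
    (size≥ : n ∸ δ ≤ suc (length (undominated (⊥ ∪ ⁅ u ⁆)))) where

    U : List (Fin n)
    U = undominated (⊥ ∪ ⁅ u ⁆)

    Undominated : Fin n → Set
    Undominated v = ¬ Dominated (⊥ ∪ ⁅ u ⁆) v

    ≁u : ∀ {v} → Undominated v → ¬ u ∼ v
    ≁u ¬dom u∼v = ¬dom (dominated-∪ʳ ⊥ (inj₂ u∼v))

    -- Only `u` has been selected, so `a` is `u` or a neighbour of `u`; the former would make `v`
    -- dominated.
    ∼u : ∀ {v a} → Undominated v → v ∼ a → Dominated (⊥ ∪ ⁅ u ⁆) a → u ∼ a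
    ∼u ¬dom v∼a dom with dominated-∪⁻ dom
    ... | inj₁ dom⊥        = contradiction dom⊥ ¬dominated-⊥
    ... | inj₂ (inj₁ refl) = contradiction (∼-sym v∼a) (≁u ¬dom)
    ... | inj₂ (inj₂ u∼a)  = u∼a

    n≤δ+1+∣U∣ : n ≤ δ + suc (length U)
    n≤δ+1+∣U∣ = ℕ.≤-trans (ℕ.m≤n+m∸n n δ) (ℕ.+-monoʳ-≤ δ size≥)

    -- By `size≥` the count in `degree+undominated<` leaves no room for a larger degree.
    degree-u : degree G u ≡ δ
    degree-u = ℕ.≤-antisym
      (ℕ.+-cancelʳ-≤ (suc (length U)) _ _ (ℕ.≤-trans (degree+undominated< u) n≤δ+1+∣U∣))
      (δ≤deg u)

    1+∣U∣≤n∸δ : suc (length U) ≤ n ∸ δ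
    1+∣U∣≤n∸δ = ℕ.m+n≤o⇒m≤o∸n _ (ℕ.≤-trans
      (ℕ.≤-reflexive (trans (ℕ.+-comm _ δ) (cong (_+ suc (length U)) (sym degree-u))))
      (degree+undominated< u))

    -- The bound on `n` in terms of `δ` enters here, to prepare the pigeonhole argument of
    -- `some-isolated`.
    δ<∣U∣ : δ < length U
    δ<∣U∣ = ℕ.≤-pred (ℕ.+-cancelˡ-≤ δ _ _ (ℕ.≤-trans
      (ℕ.≤-reflexive (rearrange δ)) (ℕ.≤-trans 2δ+2≤n n≤δ+1+∣U∣)))
      where
      rearrange : ∀ d → d + suc (suc d) ≡ 2 * d + 2
      rearrange = solve-∀

    -- If the best reply `a` to `v` also dominated another `w` in `U`, two vertices would be
    -- selected while at least two leave `U`. The value would then be at most `length U`, which is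
    -- below `n ∸ δ`.
    private-reply : ∀ {v} → Undominated v →
      ∃[ a ] a ∈N[ v ] × (∀ {w} → Undominated w → a ∈N[ w ] → w ≡ v)
    private-reply {v} ¬dom with value-≤-reply ¬dom
    ... | a , a∈N , le = a , a∈N , λ {w} ¬domw a∈Nw → decidable-stable (w Fin.≟ v) λ w≢v →
      ℕ.<-irrefl refl (begin-strict
        length U                       <⟨ 1+∣U∣≤n∸δ ⟩
        n ∸ δ                          ≤⟨ value≥ ⟩
        value (⊥ ∪ ⁅ u ⁆)              ≤⟨ le ⟩
        value ((⊥ ∪ ⁅ u ⁆) ∪ ⁅ a ⁆)      ≤⟨ valueWithin≤ n _ ⟩
        ∣ (⊥ ∪ ⁅ u ⁆) ∪ ⁅ a ⁆ ∣ + length (undominated ((⊥ ∪ ⁅ u ⁆) ∪ ⁅ a ⁆))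
          ≤⟨ ℕ.+-monoˡ-≤ _ (ℕ.≤-trans (∣p∪⁅x⁆∣≤1+∣p∣ (⊥ ∪ ⁅ u ⁆) a) (s≤s (∣⊥∪⁅x⁆∣≤1 u))) ⟩
        2 + length (undominated ((⊥ ∪ ⁅ u ⁆) ∪ ⁅ a ⁆))
          ≤⟨ undominated-shrinks {ws = w ∷ v ∷ []} ((w≢v ∷ []) ∷ [] ∷ []) (λ where
               (here refl)         → ¬domw , a∈Nw
               (there (here refl)) → ¬dom , a∈N) ⟩
        length U                       ∎)
      where open ℕ.≤-Reasoning

    Isolated : Fin n → Set
    Isolated v = ∀ {w} → Undominated w → ¬ v ∼ w

    HasPrivateNeighbour : Fin n → Set
    HasPrivateNeighbour v = ∃[ a ] u ∼ a × a ∼ v × (∀ {w} → Undominated w → a ∼ w → w ≡ v)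

    isolated-or-private : ∀ {v} → Undominated v → Isolated v ⊎ HasPrivateNeighbour v
    isolated-or-private {v} ¬dom with private-reply ¬dom
    ... | _ , inj₁ refl , priv = inj₁ λ ¬domw v∼w → ∼-irrefl (sym (priv ¬domw (inj₂ v∼w))) v∼w
    ... | a , inj₂ a∼v  , priv = inj₂ (a , ∼u ¬dom (∼-sym a∼v) dom-a , a∼v , λ ¬domw a∼w → priv ¬domw (inj₂ a∼w))
      where
      dom-a : Dominated (⊥ ∪ ⁅ u ⁆) a
      -- Were `a` undominated, privacy applied to `a` itself would give `a ≡ v`, against `a ∼ v`.
      dom-a = decidable-stable (dominated? _ a) λ ¬doma →
        ∼-irrefl (priv ¬doma (inj₁ refl)) a∼v

    some-isolated : ∃[ v ] Undominated v × Isolated v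
    some-isolated with All.decide classify (allFin n)
      where
      -- Dominated vertices fall vacuously on the left, so `All.decide` can scan all of `allFin n`.
      classify : ∀ v → (Undominated v → HasPrivateNeighbour v) ⊎ (Undominated v × Isolated v)
      classify v with dominated? (⊥ ∪ ⁅ u ⁆) v
      ... | yes dom = inj₁ λ ¬dom → contradiction dom ¬dom
      ... | no ¬dom with isolated-or-private ¬dom
      ...   | inj₁ iso  = inj₂ (¬dom , iso)
      ...   | inj₂ priv = inj₁ λ _ → priv
    ... | inj₂ some = Any.satisfied some
    ... | inj₁ all  = contradiction ∣U∣≤δ (ℕ.<⇒≱ δ<∣U∣)
      where
      priv : ∀ {v} → v ∈ₗ U → HasPrivateNeighbour v
      priv v∈U = All.lookup all (∈-allFin _) (undominated⁻ v∈U)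

      ∣U∣≤δ : length U ≤ δ
      ∣U∣≤δ = ℕ.≤-trans (injection⇒length≤ (undominated-unique _) (λ v∈U → proj₁ (priv v∈U))
        (λ v∈U → ∈-filter⁺ (u ∼?_) (∈-allFin _) (proj₁ (proj₂ (priv v∈U)))) private-injective)
        (ℕ.≤-reflexive degree-u)
        where
        private-injective : ∀ {v w} (v∈U : v ∈ₗ U) (w∈U : w ∈ₗ U) →
                            proj₁ (priv v∈U) ≡ proj₁ (priv w∈U) → v ≡ w
        private-injective v∈U w∈U eq with priv v∈U | priv w∈U
        -- The shared `a` is adjacent to the first vertex and private to the second, so the two
        -- coincide.
        ... | a , _ , a∼v , _ | _ , _ , _ , only-w with refl ← eq = only-w (undominated⁻ v∈U) a∼v

    -- The neighbours of `v` are all dominated, so they lie in N(u). If `a` were not among them,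
    -- N(u) would be strictly larger than N(v), and `v` would have degree below `δ`.
    twin : ∀ {v a} → Undominated v → Isolated v → u ∼ a → v ∼ a
    twin {v} {a} ¬dom iso u∼a = decidable-stable (v ∼? a) λ v≁a →
      ℕ.<-irrefl refl (begin-strict
        degree G v               <⟨ ⊆⇒length≤ (new v≁a ∷ filter⁺ (v ∼?_) (allFin⁺ n)) included ⟩
        degree G u               ≡⟨ degree-u ⟩
        δ                        ≤⟨ δ≤deg v ⟩
        degree G v               ∎)
      where
      open ℕ.≤-Reasoning

      new : ¬ v ∼ a → All (a ≢_) (neighbours v)
      new v≁a = All.map (λ v∼x a≡x → v≁a (subst (v ∼_) (sym a≡x) v∼x)) (all-filter (v ∼?_) (allFin n))

      included : ∀ {x} → x ∈ₗ a ∷ neighbours v → x ∈ₗ neighbours u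
      included (here refl) = ∈-filter⁺ (u ∼?_) (∈-allFin _) u∼a
      included (there x∈) with v∼x ← proj₂ (∈-filter⁻ (v ∼?_) {xs = allFin n} x∈) =
        ∈-filter⁺ (u ∼?_) (∈-allFin _) (∼u ¬dom v∼x
          (decidable-stable (dominated? _ _) λ ¬domx → iso ¬domx v∼x))

    all-isolated : ∀ {w} → Undominated w → Isolated w
    all-isolated ¬domw with some-isolated | isolated-or-private ¬domw
    ... | _              | inj₁ iso              = iso
    ... | v , ¬dom , iso | inj₂ (a , u∼a , _ , priv)
      -- By `twin`, `a` is adjacent to the isolated vertex `v`; being private, it identifies `v`
      -- with the vertex in question, which is therefore isolated after all.
      with refl ← priv ¬dom (∼-sym (twin ¬dom iso u∼a)) = iso

    ≁u⇒≡u⊎undominated : ∀ {x} → ¬ u ∼ x → u ≡ x ⊎ Undominated x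
    ≁u⇒≡u⊎undominated {x} u≁x with u Fin.≟ x
    ... | yes u≡x = inj₁ u≡x
    ... | no  u≢x = inj₂ λ dom → case-dom (dominated-∪⁻ dom)
      where
      case-dom : ¬ (Dominated ⊥ x ⊎ u ∈N[ x ])
      case-dom (inj₁ dom⊥)       = ¬dominated-⊥ dom⊥
      case-dom (inj₂ (inj₁ u≡x)) = u≢x u≡x
      case-dom (inj₂ (inj₂ u∼x)) = u≁x u∼x

    joined : ∀ {x y} → ¬ u ∼ x → u ∼ y → x ∼ y
    joined u≁x u∼y with ≁u⇒≡u⊎undominated u≁x
    ... | inj₁ refl = u∼y
    ... | inj₂ ¬dom = twin ¬dom (all-isolated ¬dom) u∼y

    independent : ∀ {x y} → ¬ u ∼ x → ¬ u ∼ y → ¬ x ∼ y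
    independent u≁x u≁y with ≁u⇒≡u⊎undominated u≁x | ≁u⇒≡u⊎undominated u≁y
    ... | inj₁ refl | _          = u≁y
    ... | inj₂ _    | inj₁ refl  = u≁x ∘ ∼-sym
    ... | inj₂ ¬dom | inj₂ ¬dom′ = all-isolated ¬dom ¬dom′

    spanningK : ContainsSpanningKWithIndependentPart G δ (n ∸ δ)
    spanningK = subst (λ d → ContainsSpanningKWithIndependentPart G d (n ∸ d)) degree-u
      (joined-independent⇒spanningK u joined independent)

-- The two directions combined

theorem4p1 : ∀ (n δ : ℕ) (G : Graph (Fin n)) →
    MinimumDegree G δ → n ≥ 2 * δ + 2 →
    (γᵢ G ≡ n ∸ δ) ⇔ ContainsSpanningKWithIndependentPart G δ (n ∸ δ)
theorem4p1 n δ G minDeg@((v , _) , δ≤deg) 2δ+2≤n = mk⇔ extremal⇒K K⇒extremal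
  where
  extremal⇒K : γᵢ G ≡ n ∸ δ → ContainsSpanningKWithIndependentPart G δ (n ∸ δ)
  extremal⇒K eq with first-reply G v
  ... | u , value≥ , size≥ = ExtremalFirstReply.spanningK G δ≤deg 2δ+2≤n u
    (ℕ.≤-trans (ℕ.≤-reflexive (sym eq)) value≥) (ℕ.≤-trans (ℕ.≤-reflexive (sym eq)) size≥)

  K⇒extremal : ContainsSpanningKWithIndependentPart G δ (n ∸ δ) → γᵢ G ≡ n ∸ δ
  K⇒extremal c = ℕ.≤-antisym (γᵢ≤n∸δ G minDeg) (spanningK⇒≤γᵢ G (ℕ.m<n⇒0<n∸m δ<n) c)
    where
    δ<n : δ < n
    -- This makes the part of size `n ∸ δ` nonempty, so that it dominates the other part.
    δ<n = ℕ.≤-trans (ℕ.≤-trans (ℕ.m≤m+n (suc δ) (suc δ)) (ℕ.≤-reflexive (rearrange δ))) 2δ+2≤n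
      where
      rearrange : ∀ d → suc d + suc d ≡ 2 * d + 2
      rearrange = solve-∀
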